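{- For any finite binary string $s$ that contains the symbol $1$, there exist a strongly connected directed graph $D$, a parallel chip-firing game on $D$, and a vertex $v$ of $D$ such that $s$ is the atomic firing sequence of $v$ in that game.
   Context: A directed graph $D=(V,E)$ is a finite set of vertices $V$ with a set $E$ of ordered pairs of vertices; $(u,v)\in E$ is an edge directed from $u$ to $v$, and the out-degree $\deg^+ v$ is the number of edges directed from $v$. It is strongly connected if there is a directed path in both directions between every pair of vertices. A parallel chip-firing game on $D$ starts with a finite nonnegative integer number of chips on each vertex. In each round, simultaneously, every vertex $v$ having at least $\deg^+ v$ chips fires, sending one chip along each of its outgoing edges; all other vertices wait. The game has period $T$ if $T$ is the smallest positive integer for which there is a round $t_0$ such that every vertex has the same number of chips in round $t$ as in round $t+T$ for all $t\ge t_0$. The least such $t_0$ is relabelled round $0$. Let $F_t(v)=1$ if $v$ fires in round $t$ and $F_t(v)=0$ otherwise. The atomic firing sequence of $v$ is the length-$T$ binary string $F_0(v)F_1(v)\cdots F_{T-1}(v)$, where $T$ is the period of the game. -}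

module Defs where

open import Data.Bool using (Bool; true; _∧_; if_then_else_)
open import Data.Fin using (Fin)
open import Data.List using (List; applyUpTo)
open import Data.Nat using (ℕ; _+_; _∸_; _≤_; _<_; _≤ᵇ_)
open import Data.Nat.GeneralisedArithmetic using (fold)
open import Data.Nat.Properties using (+-0-commutativeMonoid)
open import Data.Product using (∃-syntax; _×_)
open import Algebra.Properties.CommutativeMonoid.Sum +-0-commutativeMonoid
  using (sum)
open import Relation.Binary.Construct.Closure.ReflexiveTransitive using (Star)
open import Relation.Binary.PropositionalEquality using (_≡_)

-- The edge set is an arbitrary set of ordered pairs, so there are no
-- multiple edges, while loops (v , v) are not excluded.
record Digraph : Set where
  field
    order : ℕ
    edge  : Fin order → Fin order → Bool

  Vertex : Set
  Vertex = Fin order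

  Edge : Vertex → Vertex → Set
  Edge u v = edge u v ≡ true

  count : (Vertex → Bool) → ℕ
  count p = sum (λ w → if p w then 1 else 0)

  deg⁺ : Vertex → ℕ
  deg⁺ v = count (edge v)

  StronglyConnected : Set
  StronglyConnected = ∀ u v → Star Edge u v

module ChipFiring (D : Digraph) where
  open Digraph D

  Configuration : Set
  Configuration = Vertex → ℕ

  fires : Configuration → Vertex → Bool
  fires c v = deg⁺ v ≤ᵇ c v

  -- The subtraction never truncates, as v only fires when deg⁺ v ≤ c v.
  step : Configuration → Configuration
  step c v = (if fires c v then c v ∸ deg⁺ v else c v)
           + count (λ u → fires c u ∧ edge u v)

  -- The dynamics are deterministic, so a game is given by its initial
  -- configuration σ.
  module Game (σ : Configuration) where

    chips : ℕ → Configuration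
    chips = fold σ step

    F : ℕ → Vertex → Bool
    F t v = fires (chips t) v

    RepeatsFrom : ℕ → ℕ → Set
    RepeatsFrom T t₀ = ∀ t → t₀ ≤ t → ∀ v → chips t v ≡ chips (t + T) v

    record IsPeriod (T : ℕ) : Set where
      field
        positive : 0 < T
        repeats  : ∃[ t₀ ] RepeatsFrom T t₀
        minimal  : ∀ T′ → 0 < T′ → ∃[ t₀ ] RepeatsFrom T′ t₀ → T ≤ T′

    -- t₀ is the round that gets relabelled as round 0 in a game of period T.
    record IsRoundZero (T t₀ : ℕ) : Set where
      field
        repeats : RepeatsFrom T t₀
        least   : ∀ t₁ → RepeatsFrom T t₁ → t₀ ≤ t₁

    IsAtomicFiringSequence : Vertex → List Bool → Set
    IsAtomicFiringSequence v s =
      ∃[ T ] ∃[ t₀ ] IsPeriod T × IsRoundZero T t₀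
                   × s ≡ applyUpTo (λ i → F (t₀ + i) v) T

{-# OPTIONS --safe #-}
-- A clock of vertices in a directed cycle passes one token around, so that exactly one
-- clock vertex fires in each round. Besides its successor, a clock vertex may feed the relay,
-- a vertex of out-degree one which fires exactly one round later; the clock vertices that
-- feed it are chosen so that the relay's firing sequence is s. The relay's chips are collected
-- by the store, whose out-degree is the number of ones of s, so that once per period it
-- fires and gives back one chip to every clock vertex that feeds the relay. Such a vertex has
-- out-degree two, and it fires when it holds both a reserve chip and the token. Since each
-- clock vertex fires once per period, the period is exactly the length of s.
module Submission where

open import Defs
open import Data.Bool using (Bool; true; false; _∧_; if_then_else_)
open import Data.Bool.Properties using (∧-zeroʳ; ∧-identityʳ)
open import Data.Fin as Fin using (Fin; zero; suc; toℕ; fromℕ; inject₁; fromℕ<)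
open import Data.Fin.Induction using (<-weakInduction; >-weakInduction)
import Data.Fin.Properties as Fin
open import Data.Fin.Relation.Unary.Top
  using (view; ‵fromℕ; ‵inject₁; view-fromℕ; view-inject₁)
open import Data.List using (List; _∷_; length; lookup; tabulate; applyUpTo)
open import Data.List.Membership.Propositional using (_∈_)
open import Data.List.Properties using (tabulate-cong; tabulate-lookup)
import Data.List.Relation.Unary.Any as Any
open import Data.List.Relation.Unary.Any.Properties using (lookup-index)
open import Data.Nat using (ℕ; zero; suc; _+_; _∸_; _≤_; _<_; _≤ᵇ_; _≤?_; z≤n; s≤s)
open import Data.Nat.GeneralisedArithmetic using (fold; fold-+)
open import Data.Nat.Properties
  using (+-0-commutativeMonoid; +-comm; +-identityʳ; +-monoʳ-<;
         +-assoc; ≤-refl; ≤-reflexive; ≤-trans; <⇒≤; ≮⇒≥; <⇒≱; ≤⇒≯; m≤n+m; n∸n≡0)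
open import Data.Product using (Σ-syntax; ∃-syntax; _×_; _,_; proj₁; proj₂)
open import Algebra.Properties.CommutativeMonoid.Sum +-0-commutativeMonoid
  using (sum; sum-cong-≗; sum-replicate-zero; sum-init-last)
open import Function using (_∘_; mk⇔)
open import Relation.Binary.Construct.Closure.ReflexiveTransitive
  using (Star; ε; _◅_; _◅◅_)
open import Relation.Binary.PropositionalEquality
  using (_≡_; _≗_; refl; sym; trans; cong; cong₂; subst; module ≡-Reasoning)
open import Relation.Nullary using (Dec; yes; no; does; contradiction)
open import Relation.Nullary.Decidable using (dec-true; dec-false; does-⇔)

-- Iterates of the cyclic successor

next : ∀ {n} → Fin (suc n) → Fin (suc n)
next i with view i
... | ‵fromℕ     = zero
... | ‵inject₁ j = suc j

next-fromℕ : ∀ n → next (fromℕ n) ≡ zero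
next-fromℕ n rewrite view-fromℕ n = refl

next-inject₁ : ∀ {n} (j : Fin n) → next (inject₁ j) ≡ suc j
next-inject₁ j rewrite view-inject₁ j = refl

module _ {n : ℕ} where

  fold-next-toℕ : (i : Fin (suc n)) → fold zero next (toℕ i) ≡ i
  fold-next-toℕ = <-weakInduction (λ i → fold zero next (toℕ i) ≡ i) refl λ j ih →
    trans (cong next (trans (cong (fold zero next) (sym (Fin.toℕ-inject₁ j))) ih))
          (next-inject₁ j)

  fold-next-order-zero : fold zero next (suc n) ≡ zero
  fold-next-order-zero = trans
    (cong next (trans (cong (fold zero next) (sym (Fin.toℕ-fromℕ n))) (fold-next-toℕ (fromℕ n))))
    (next-fromℕ n)

  fold-next-comm : ∀ (i : Fin (suc n)) a b →
                   fold (fold i next a) next b ≡ fold (fold i next b) next a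
  fold-next-comm i a b = begin
    fold (fold i next a) next b ≡⟨ fold-+ i next b ⟨
    fold i next (b + a)         ≡⟨ cong (fold i next) (+-comm b a) ⟩
    fold i next (a + b)         ≡⟨ fold-+ i next a ⟩
    fold (fold i next b) next a ∎
    where open ≡-Reasoning

  -- As `i` is itself an iterate of `next` at `zero`, a full turn from `i` commutes back to a full
  -- turn from `zero`.
  fold-next-order : (i : Fin (suc n)) → fold i next (suc n) ≡ i
  fold-next-order i = begin
    fold i next (suc n)
      ≡⟨ cong (λ j → fold j next (suc n)) (fold-next-toℕ i) ⟨
    fold (fold zero next (toℕ i)) next (suc n)
      ≡⟨ fold-next-comm zero (toℕ i) (suc n) ⟩
    fold (fold zero next (suc n)) next (toℕ i)
      ≡⟨ cong (λ j → fold j next (toℕ i)) fold-next-order-zero ⟩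
    fold zero next (toℕ i)
      ≡⟨ fold-next-toℕ i ⟩
    i ∎
    where open ≡-Reasoning

  -- A further `n` steps complete a full turn, so the `n`-th iterate is an inverse of `next`.
  next-injective : {i j : Fin (suc n)} → next i ≡ next j → i ≡ j
  next-injective {i} {j} eq = begin
    i                   ≡⟨ fold-next-order i ⟨
    fold i next (suc n) ≡⟨ fold-next-comm i n 1 ⟩
    fold (next i) next n ≡⟨ cong (λ k → fold k next n) eq ⟩
    fold (next j) next n ≡⟨ fold-next-comm j n 1 ⟨
    fold j next (suc n) ≡⟨ fold-next-order j ⟩
    j                   ∎
    where open ≡-Reasoning

  fold-next-injective : ∀ a {i j : Fin (suc n)} → fold i next a ≡ fold j next a → i ≡ j
  fold-next-injective zero    eq = eq
  fold-next-injective (suc a) eq = fold-next-injective a (next-injective eq)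

  fold-next-surjective : ∀ a (j : Fin (suc n)) → ∃[ i ] fold i next a ≡ j
  fold-next-surjective zero    j = j , refl
  fold-next-surjective (suc a) j =
    -- Going `n` steps forward reaches the cyclic predecessor of `j`.
    let i , eq = fold-next-surjective a (fold j next n)
    in i , trans (cong next eq) (fold-next-order j)

  -- Cancelling the steps from `zero` to `i` makes `zero` a fixed point too; but `a < suc n` steps
  -- from `zero` end at position `a`, which would then be 0.
  fold-next-fixed : ∀ (i : Fin (suc n)) {a} → 0 < a → fold i next a ≡ i → suc n ≤ a
  fold-next-fixed i {a} 0<a eq = ≮⇒≥ λ a<1+n →
    let k  = fromℕ< a<1+n
        ka = Fin.toℕ-fromℕ< a<1+n
        k≡0 = trans (sym (fold-next-toℕ k)) (trans (cong (fold zero next) ka) a-fixes-zero)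
    in <⇒≱ 0<a (≤-reflexive (trans (sym ka) (cong toℕ k≡0)))
    where
    open ≡-Reasoning
    a-fixes-zero : fold zero next a ≡ zero
    a-fixes-zero = fold-next-injective (toℕ i) (begin
      fold (fold zero next a) next (toℕ i) ≡⟨ fold-next-comm zero a (toℕ i) ⟩
      fold (fold zero next (toℕ i)) next a ≡⟨ cong (λ j → fold j next a) (fold-next-toℕ i) ⟩
      fold i next a                        ≡⟨ eq ⟩
      i                                    ≡⟨ fold-next-toℕ i ⟨
      fold zero next (toℕ i)               ∎)

-- Sums of bits and partial sums

bit : Bool → ℕ
bit b = if b then 1 else 0

sum-bit-false : ∀ {n} (b : Fin n → Bool) → (∀ i → b i ≡ false) → sum (bit ∘ b) ≡ 0
sum-bit-false {n} b b≡false =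
  trans (sum-cong-≗ (cong bit ∘ b≡false)) (sum-replicate-zero n)

-- Isolates the single contributing clock vertex: the successor in an out-degree, the token holder
-- among the senders of chips.
sum-bit-≟ : ∀ {n} (q : Fin n) (b : Fin n → Bool) →
            sum (λ i → bit (does (i Fin.≟ q) ∧ b i)) ≡ bit (b q)
sum-bit-≟ {suc n} zero b =
  trans (cong (bit (b zero) +_) (sum-bit-false {n} (λ _ → false) λ _ → refl)) (+-identityʳ _)
sum-bit-≟ (suc q) b = sum-bit-≟ q (b ∘ suc)

sum-∘-next : ∀ {n} (h : Fin (suc n) → ℕ) → sum (h ∘ next) ≡ sum h
sum-∘-next {n} h = begin
  sum (h ∘ next)                                          ≡⟨ sum-init-last (h ∘ next) ⟩
  sum (λ j → h (next (inject₁ j))) + h (next (fromℕ n))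
    ≡⟨ cong₂ _+_ (sum-cong-≗ (cong h ∘ next-inject₁)) (cong h (next-fromℕ n)) ⟩
  sum (h ∘ suc) + h zero                                  ≡⟨ +-comm (sum (h ∘ suc)) (h zero) ⟩
  sum h                                                   ∎
  where open ≡-Reasoning

partialSum : ∀ {n} → (Fin n → ℕ) → Fin n → ℕ
partialSum h zero    = h zero
partialSum h (suc i) = h zero + partialSum (h ∘ suc) i

partialSum-suc : ∀ {n} (h : Fin (suc n) → ℕ) (i : Fin n) →
                 partialSum h (suc i) ≡ partialSum h (inject₁ i) + h (suc i)
partialSum-suc h zero    = refl
partialSum-suc h (suc i) =
  trans (cong (h zero +_) (partialSum-suc (h ∘ suc) i)) (sym (+-assoc (h zero) _ _))

partialSum-fromℕ : ∀ {n} (h : Fin (suc n) → ℕ) → partialSum h (fromℕ n) ≡ sum h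
partialSum-fromℕ {zero}  h = sym (+-identityʳ _)
partialSum-fromℕ {suc n} h = cong (h zero +_) (partialSum-fromℕ (h ∘ suc))

-- Every shorter prefix misses the positive last entry. This keeps the store below its out-degree
-- before the last state.
partialSum-< : ∀ {n} (h : Fin (suc n) → ℕ) → 0 < h (fromℕ n) → (i : Fin n) →
               partialSum h (inject₁ i) < partialSum h (fromℕ n)
partialSum-< h 0<h (suc i) = +-monoʳ-< (h zero) (partialSum-< (h ∘ suc) 0<h i)
partialSum-< {suc n} h 0<h zero = subst (_< partialSum h (fromℕ (suc n))) (+-identityʳ _)
  (+-monoʳ-< (h zero) (positive n (h ∘ suc) 0<h))
  where
  positive : ∀ n (h : Fin (suc n) → ℕ) → 0 < h (fromℕ n) → 0 < partialSum h (fromℕ n)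
  positive zero    h 0<h = 0<h
  positive (suc n) h 0<h = ≤-trans (positive n (h ∘ suc) 0<h) (m≤n+m _ (h zero))

applyUpTo-tabulate : ∀ {A : Set} (h : ℕ → A) n → tabulate {n = n} (h ∘ toℕ) ≡ applyUpTo h n
applyUpTo-tabulate h zero    = refl
applyUpTo-tabulate h (suc n) = cong (h 0 ∷_) (applyUpTo-tabulate (h ∘ suc) n)

-- Orbits of the dynamics

module _ (D : Digraph) where
  open Digraph D
  open ChipFiring D

  fires-cong : ∀ (c d : Configuration) v → c v ≡ d v → fires c v ≡ fires d v
  fires-cong c d v = cong (deg⁺ v ≤ᵇ_)

  step-cong : ∀ {c d : Configuration} → c ≗ d → step c ≗ step d
  step-cong {c} {d} c≗d v = cong₂ _+_
    (cong₂ (λ b x → if b then x ∸ deg⁺ v else x) (fires-cong c d v (c≗d v)) (c≗d v))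
    (sum-cong-≗ λ u → cong (λ b → bit (b ∧ edge u v)) (fires-cong c d u (c≗d u)))

  -- Reduces a game to iterating a map on state labels. Configurations agree only pointwise, so the
  -- induction passes through `step-cong`.
  chips-orbit : ∀ {S : Set} (C : S → Configuration) (f : S → S) →
                (∀ q → step (C q) ≗ C (f q)) →
                ∀ p t → Game.chips (C p) t ≗ C (fold p f t)
  chips-orbit C f stepC p zero    v = refl
  chips-orbit C f stepC p (suc t) v =
    trans (step-cong (chips-orbit C f stepC p t) v) (stepC (fold p f t) v)

-- The graph and its states

pattern relay   = zero
pattern store   = suc zero
pattern clock i = suc (suc i)

module Construction {n : ℕ} (f : Fin (suc n) → Bool) (f-last : f (fromℕ n) ≡ true) where

  -- State q has the token at clock vertex q. The relay is to fire in state q iff f (next q)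
  -- rather than f q: with this shift the store, starting from the chip f zero in state zero,
  -- is full exactly in state fromℕ n, because f (fromℕ n) is true. A chip sent to the relay in
  -- state i arrives in state next i, whence the double next.
  feeds : Fin (suc n) → Bool
  feeds i = f (next (next i))

  edges : Fin (3 + n) → Fin (3 + n) → Bool
  edges relay     store     = true
  edges relay     _         = false
  edges store     (clock i) = feeds i
  edges store     _         = false
  edges (clock i) relay     = feeds i
  edges (clock i) store     = false
  -- For `n = 0` this is a loop at the only clock vertex.
  edges (clock i) (clock j) = does (j Fin.≟ next i)

  D : Digraph
  D = record { order = 3 + n ; edge = edges }

  open Digraph D
  open ChipFiring D

  -- A feeding clock vertex spends its reserve when it passes the token on and regains it when the
  -- store fires in the last state, so it has one in state `q` exactly if `q ≤ i`.
  config : Fin (suc n) → Configuration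
  config q relay     = bit (f (next q))
  config q store     = partialSum (bit ∘ f) q
  config q (clock i) = bit (does (i Fin.≟ q)) + bit (does (q Fin.≤? i) ∧ feeds i)

  -- Out-degrees and firing

  deg⁺-relay : deg⁺ relay ≡ 1
  deg⁺-relay = cong suc (sum-bit-false {suc n} (λ _ → false) λ _ → refl)

  -- The double rotation in `feeds` preserves the number of ones, so the threshold is what the store
  -- holds in the last state.
  deg⁺-store : deg⁺ store ≡ partialSum (bit ∘ f) (fromℕ n)
  deg⁺-store = begin
    sum (bit ∘ f ∘ next ∘ next)      ≡⟨ sum-∘-next (bit ∘ f ∘ next) ⟩
    sum (bit ∘ f ∘ next)             ≡⟨ sum-∘-next (bit ∘ f) ⟩
    sum (bit ∘ f)                    ≡⟨ partialSum-fromℕ (bit ∘ f) ⟨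
    partialSum (bit ∘ f) (fromℕ n)   ∎
    where open ≡-Reasoning

  deg⁺-clock : ∀ i → deg⁺ (clock i) ≡ bit (feeds i) + 1
  deg⁺-clock i = cong (bit (feeds i) +_) (begin
    sum (λ j → bit (does (j Fin.≟ next i)))
      ≡⟨ sum-cong-≗ (λ j → cong bit (∧-identityʳ (does (j Fin.≟ next i)))) ⟨
    sum (λ j → bit (does (j Fin.≟ next i) ∧ true))    ≡⟨ sum-bit-≟ (next i) (λ _ → true) ⟩
    1                                                 ∎)
    where open ≡-Reasoning

  fires-relay : ∀ q → fires (config q) relay ≡ f (next q)
  fires-relay q = trans (cong (_≤ᵇ bit (f (next q))) deg⁺-relay) (compare (f (next q)))
    where
    compare : ∀ b → (1 ≤ᵇ bit b) ≡ b
    compare true  = refl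
    compare false = refl

  fires-store : ∀ q → fires (config q) store ≡ does (q Fin.≟ fromℕ n)
  fires-store q = trans (cong (_≤ᵇ partialSum (bit ∘ f) q) deg⁺-store) (compare q)
    where
    0<last : 0 < bit (f (fromℕ n))
    0<last rewrite f-last = ≤-refl
    compare : ∀ q → does (partialSum (bit ∘ f) (fromℕ n) ≤? partialSum (bit ∘ f) q)
                  ≡ does (q Fin.≟ fromℕ n)
    compare q with view q
    ... | ‵fromℕ     = trans (dec-true (partialSum (bit ∘ f) (fromℕ n) ≤? _) ≤-refl)
                             (sym (dec-true (fromℕ n Fin.≟ fromℕ n) refl))
    ... | ‵inject₁ j = trans (dec-false (_ ≤? _) (<⇒≱ (partialSum-< (bit ∘ f) 0<last j)))
                             (sym (dec-false (inject₁ j Fin.≟ fromℕ n) (Fin.fromℕ≢inject₁ ∘ sym)))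

  -- At the token holder the reserve is still present, and together with the token it equals the
  -- out-degree; elsewhere at most the reserve is there, which is too little.
  fires-clock : ∀ q i → fires (config q) (clock i) ≡ does (i Fin.≟ q)
  fires-clock q i rewrite deg⁺-clock i with i Fin.≟ q
  ... | yes refl rewrite dec-true (i Fin.≤? i) Fin.≤-refl with feeds i
  ...   | true  = refl
  ...   | false = refl
  fires-clock q i | no _ with does (q Fin.≤? i) | feeds i
  ...   | true  | true  = refl
  ...   | true  | false = refl
  ...   | false | true  = refl
  ...   | false | false = refl

  -- Transitions between states

  received : Fin (suc n) → Vertex → ℕ
  received q v = count (λ u → fires (config q) u ∧ edge u v)

  received-relay : ∀ q → received q relay ≡ bit (feeds q)
  received-relay q
    rewrite ∧-zeroʳ (fires (config q) relay) | ∧-zeroʳ (fires (config q) store)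
    = trans (sum-cong-≗ λ i → cong (λ b → bit (b ∧ feeds i)) (fires-clock q i))
            (sum-bit-≟ q feeds)

  received-store : ∀ q → received q store ≡ bit (f (next q))
  received-store q
    rewrite ∧-identityʳ (fires (config q) relay) | ∧-zeroʳ (fires (config q) store)
          | fires-relay q
    = trans (cong (bit (f (next q)) +_)
                  (sum-bit-false _ λ i → ∧-zeroʳ (fires (config q) (clock i))))
            (+-identityʳ _)

  received-clock : ∀ q j → received q (clock j) ≡
                   bit (does (q Fin.≟ fromℕ n) ∧ feeds j) + bit (does (j Fin.≟ next q))
  received-clock q j rewrite ∧-zeroʳ (fires (config q) relay) | fires-store q
    = cong (bit (does (q Fin.≟ fromℕ n) ∧ feeds j) +_)
        (trans (sum-cong-≗ λ i → cong (λ b → bit (b ∧ edge (clock i) (clock j))) (fires-clock q i))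
               (sum-bit-≟ q (λ i → does (j Fin.≟ next i))))

  step-value : ∀ q v {b d r} → fires (config q) v ≡ b → deg⁺ v ≡ d → received q v ≡ r →
               step (config q) v ≡ (if b then config q v ∸ d else config q v) + r
  step-value q v refl refl refl = refl

  step-relay : ∀ q → step (config q) relay ≡ config (next q) relay
  step-relay q = trans (step-value q relay (fires-relay q) deg⁺-relay (received-relay q))
                       -- Whether it fires or waits, the relay ends up empty before receiving, and
                       -- `feeds q` unfolds to its chip in state `next q`.
                       (spent (f (next q)))
    where
    spent : ∀ b → (if b then bit b ∸ 1 else bit b) + bit (feeds q) ≡ bit (feeds q)
    spent true  = refl
    spent false = refl

  step-store : ∀ q → step (config q) store ≡ config (next q) store
  step-store q = trans (step-value q store (fires-store q) deg⁺-store (received-store q))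
                       (transition q)
    where
    transition : ∀ q →
      (if does (q Fin.≟ fromℕ n) then partialSum (bit ∘ f) q ∸ partialSum (bit ∘ f) (fromℕ n)
                                 else partialSum (bit ∘ f) q)
      + bit (f (next q)) ≡ partialSum (bit ∘ f) (next q)
    transition q with view q
    ... | ‵fromℕ rewrite dec-true (fromℕ n Fin.≟ fromℕ n) refl
      -- The store is emptied exactly, and the chip arriving now is the first of the next turn.
      = cong (_+ bit (f zero)) (n∸n≡0 (partialSum (bit ∘ f) (fromℕ n)))
    ... | ‵inject₁ j rewrite dec-false (inject₁ j Fin.≟ fromℕ n) (Fin.fromℕ≢inject₁ ∘ sym)
      = sym (partialSum-suc (bit ∘ f) j)

  step-clock : ∀ q i → step (config q) (clock i) ≡ config (next q) (clock i)
  step-clock q i =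
    trans (step-value q (clock i) (fires-clock q i) (deg⁺-clock i) (received-clock q i))
          (trans (cong (_+ (sent-back + token)) (spent (i Fin.≟ q)))
                 (trans (sym (+-assoc kept sent-back token))
                        (trans (+-comm (kept + sent-back) token) (cong (token +_) (reserve q i)))))
    where
    sent-back token kept : ℕ
    sent-back = bit (does (q Fin.≟ fromℕ n) ∧ feeds i)
    token     = bit (does (i Fin.≟ next q))
    kept      = bit (does (q Fin.<? i) ∧ feeds i)

    spent : (i≟q : Dec (i ≡ q)) → let c = bit (does i≟q) + bit (does (q Fin.≤? i) ∧ feeds i) in
            (if does i≟q then c ∸ (bit (feeds i) + 1) else c) ≡ kept
    spent (yes refl)
      rewrite dec-true (q Fin.≤? q) Fin.≤-refl | dec-false (q Fin.<? q) (Fin.<-irrefl refl)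
            | +-comm (bit (feeds q)) 1
      = n∸n≡0 (bit (feeds q))
    spent (no i≢q) = cong (λ b → bit (b ∧ feeds i)) (does-⇔
      (mk⇔ (λ q≤i → Fin.≤∧≢⇒< q≤i (i≢q ∘ sym)) <⇒≤)
      (q Fin.≤? i) (q Fin.<? i))

    reserve : ∀ q i → bit (does (q Fin.<? i) ∧ feeds i) + bit (does (q Fin.≟ fromℕ n) ∧ feeds i)
                    ≡ bit (does (next q Fin.≤? i) ∧ feeds i)
    reserve q i with view q
    -- No reserve survives the last state, but the store restores all of them, as state `zero`
    -- requires.
    ... | ‵fromℕ rewrite dec-true (fromℕ n Fin.≟ fromℕ n) refl
                       | dec-false (fromℕ n Fin.<? i) (≤⇒≯ (Fin.≤fromℕ i)) = refl
    -- Here the store is silent, and `inject₁ j < i` is the same condition as `suc j ≤ i`.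
    ... | ‵inject₁ j rewrite dec-false (inject₁ j Fin.≟ fromℕ n) (Fin.fromℕ≢inject₁ ∘ sym)
                           | Fin.toℕ-inject₁ j = +-identityʳ _

  step-config : ∀ q → step (config q) ≗ config (next q)
  step-config q relay     = step-relay q
  step-config q store     = step-store q
  step-config q (clock i) = step-clock q i

  -- Strong connectivity

  clock-edge : ∀ i → Edge (clock i) (clock (next i))
  clock-edge i = dec-true (next i Fin.≟ next i) refl

  clock⇒zero : ∀ i → Star Edge (clock i) (clock zero)
  clock⇒zero = >-weakInduction (λ i → Star Edge (clock i) (clock zero))
    (subst (Edge (clock (fromℕ n)) ∘ clock) (next-fromℕ n) (clock-edge (fromℕ n)) ◅ ε)
    (λ j path → subst (Edge (clock (inject₁ j)) ∘ clock) (next-inject₁ j)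
                      (clock-edge (inject₁ j)) ◅ path)

  zero⇒clock : ∀ i → Star Edge (clock zero) (clock i)
  zero⇒clock = <-weakInduction (λ i → Star Edge (clock zero) (clock i)) ε
    (λ j path → path ◅◅ subst (Edge (clock (inject₁ j)) ∘ clock) (next-inject₁ j)
                              (clock-edge (inject₁ j)) ◅ ε)

  -- This witness serves both directions, since `feeds` governs the edges into the relay as well as
  -- those out of the store.
  feeder : Fin (suc n)
  feeder = proj₁ (fold-next-surjective 2 (fromℕ n))

  feeder-feeds : feeds feeder ≡ true
  feeder-feeds = trans (cong f (proj₂ (fold-next-surjective 2 (fromℕ n)))) f-last

  clock⇒relay : ∀ i → Star Edge (clock i) relay
  clock⇒relay i = clock⇒zero i ◅◅ zero⇒clock feeder ◅◅ feeder-feeds ◅ ε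

  ⇒relay : ∀ v → Star Edge v relay
  ⇒relay relay     = ε
  ⇒relay store     = feeder-feeds ◅ clock⇒relay feeder
  ⇒relay (clock i) = clock⇒relay i

  relay⇒ : ∀ v → Star Edge relay v
  relay⇒ relay     = ε
  relay⇒ store     = refl ◅ ε
  relay⇒ (clock i) = _◅_ {j = store} refl (feeder-feeds ◅ clock⇒zero feeder ◅◅ zero⇒clock i)

  stronglyConnected : StronglyConnected
  stronglyConnected u v = ⇒relay u ◅◅ relay⇒ v

  -- Period and round zero

  config-injective : ∀ {q q′} → config q ≗ config q′ → q ≡ q′
  config-injective {q} {q′} eq with q Fin.≟ q′
  ... | yes q≡q′ = q≡q′
  ... | no  q≢q′ = contradiction true≡false λ ()
    where
    open ≡-Reasoning
    true≡false : true ≡ false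
    -- A configuration reveals its state through the one clock vertex that fires.
    true≡false = begin
      true                        ≡⟨ dec-true (q Fin.≟ q) refl ⟨
      does (q Fin.≟ q)            ≡⟨ fires-clock q q ⟨
      fires (config q) (clock q)  ≡⟨ fires-cong D (config q) (config q′) (clock q) (eq (clock q)) ⟩
      fires (config q′) (clock q) ≡⟨ fires-clock q′ q ⟩
      does (q Fin.≟ q′)           ≡⟨ dec-false (q Fin.≟ q′) q≢q′ ⟩
      false                       ∎

  module _ (p : Fin (suc n)) where
    open Game (config p)

    chips-config : ∀ t → chips t ≗ config (fold p next t)
    chips-config = chips-orbit D config next step-config p

    F-relay : ∀ t → F t relay ≡ f (fold p next (suc t))
    F-relay t = trans
      (fires-cong D (chips t) (config (fold p next t)) relay (chips-config t relay))
      (fires-relay (fold p next t))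

    repeatsFrom-zero : RepeatsFrom (suc n) 0
    repeatsFrom-zero t _ v = begin
      chips t v                                       ≡⟨ chips-config t v ⟩
      config (fold p next t) v
        ≡⟨ cong (λ q → config (fold q next t) v) (fold-next-order p) ⟨
      config (fold (fold p next (suc n)) next t) v    ≡⟨ cong (λ q → config q v) (fold-+ p next t) ⟨
      config (fold p next (t + suc n)) v              ≡⟨ chips-config (t + suc n) v ⟨
      chips (t + suc n) v                             ∎
      where open ≡-Reasoning

    -- Agreement at the single round `t₀` already makes `T` steps fix a state.
    period-minimal : ∀ T → 0 < T → ∃[ t₀ ] RepeatsFrom T t₀ → suc n ≤ T
    period-minimal T 0<T (t₀ , repeats) = fold-next-fixed (fold p next t₀) 0<T (begin
      fold (fold p next t₀) next T ≡⟨ fold-next-comm p t₀ T ⟩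
      fold (fold p next T) next t₀ ≡⟨ fold-+ p next t₀ ⟨
      fold p next (t₀ + T)         ≡⟨ config-injective (λ v → trans (sym (chips-config t₀ v))
                                        (trans (repeats t₀ ≤-refl v) (chips-config (t₀ + T) v))) ⟨
      fold p next t₀               ∎)
      where open ≡-Reasoning

    isPeriod : IsPeriod (suc n)
    isPeriod = record
      { positive = s≤s z≤n
      ; repeats  = 0 , repeatsFrom-zero
      ; minimal  = period-minimal
      }

    -- The game starts on its cycle of configurations, so the rounds keep their labels.
    isRoundZero : IsRoundZero (suc n) 0
    isRoundZero = record { repeats = repeatsFrom-zero ; least = λ _ _ → z≤n }

-- Choice of rotation and starting state

theorem4p6 : (s : List Bool) → true ∈ s →
    Σ[ D ∈ Digraph ] Digraph.StronglyConnected D ×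
    (Σ[ σ ∈ ChipFiring.Configuration D ] Σ[ v ∈ Digraph.Vertex D ]
    ChipFiring.Game.IsAtomicFiringSequence D σ v s)
theorem4p6 s@(x ∷ xs) true∈s =
  D , stronglyConnected , config start , relay ,
  suc n , 0 , isPeriod start , isRoundZero start , (begin
    s                                                       ≡⟨ tabulate-lookup s ⟨
    tabulate (lookup s)                                     ≡⟨ tabulate-cong lookup-F ⟩
    tabulate (λ i → Game.F (config start) (toℕ i) relay)
      ≡⟨ applyUpTo-tabulate (λ t → Game.F (config start) t relay) (suc n) ⟩
    applyUpTo (λ t → Game.F (config start) t relay) (suc n) ∎)
  where
  open ≡-Reasoning
  n = length xs
  one = Any.index true∈s

  -- s is rotated so that its symbol at position one becomes the last.
  shift = suc (toℕ one)

  f : Fin (suc n) → Bool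
  f q = lookup s (fold q next shift)

  -- The successor in `shift` accounts for the wrap from the last index to `zero`.
  f-last : f (fromℕ n) ≡ true
  f-last = trans (cong (lookup s) (begin
    fold (fromℕ n) next shift               ≡⟨ fold-next-comm (fromℕ n) (toℕ one) 1 ⟩
    fold (next (fromℕ n)) next (toℕ one)    ≡⟨ cong (λ q → fold q next (toℕ one)) (next-fromℕ n) ⟩
    fold zero next (toℕ one)                ≡⟨ fold-next-toℕ one ⟩
    one                                     ∎)) (sym (lookup-index true∈s))

  open Construction f f-last
  open ChipFiring D using (module Game)

  -- The `shift` steps undo the rotation in `f`; the extra one is the lead of the relay, which in
  -- state `q` reads `f (next q)`.
  start : Fin (suc n)
  start = proj₁ (fold-next-surjective (shift + 1) zero)

  lookup-F : ∀ i → lookup s i ≡ Game.F (config start) (toℕ i) relay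
  lookup-F i = sym (trans (F-relay start (toℕ i)) (cong (lookup s) (begin
    fold (fold start next (suc (toℕ i))) next shift
      ≡⟨ cong (λ q → fold q next shift) (fold-next-comm start (toℕ i) 1) ⟩
    fold (fold (next start) next (toℕ i)) next shift
      ≡⟨ fold-next-comm (next start) (toℕ i) shift ⟩
    fold (fold (next start) next shift) next (toℕ i)
      ≡⟨ cong (λ q → fold q next (toℕ i)) (fold-+ start next shift) ⟨
    fold (fold start next (shift + 1)) next (toℕ i)
      ≡⟨ cong (λ q → fold q next (toℕ i)) (proj₂ (fold-next-surjective (shift + 1) zero)) ⟩
    fold zero next (toℕ i)                                ≡⟨ fold-next-toℕ i ⟩
    i                                                     ∎)))
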